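{- For every $\varepsilon\in(0,1/2)$ there exist $\delta=\delta_\varepsilon>0$ and an integer $N_{\varepsilon,\delta}$ such that for every integer $N\ge N_{\varepsilon,\delta}$ there is a set $\mathcal E(N)\subset\{0,1\}^N$ with $\#\mathcal E(N)\le \varepsilon\, 2^N$ such that for every $\mathfrak u\in\{0,1\}^N\setminus\mathcal E(N)$ and every integer $0\le k\le\lfloor\delta N\rfloor$ one has $R_{\mathfrak w}(k)\in[1/2-\varepsilon,1/2+\varepsilon]$ and $R_{\mathfrak e}(k)\in[1/2-\varepsilon,1/2+\varepsilon]$, where these proportions are computed in the P-G triangle of side $N$ generated by $\mathfrak u$.
   Context: For $\mathfrak u=(a_0,\dots,a_{N-1})\in\{0,1\}^N$, the P-G triangle of side $N$ generated by $\mathfrak u$ consists of the numbers $d_i^{(j)}\in\{0,1\}$, $j\ge0$, $0\le i\le N-1-j$, with $d_i^{(0)}=a_i$ and $d_i^{(j+1)}=|d_{i+1}^{(j)}-d_i^{(j)}|$. For $0\le k\le N-1$, the western ray $\mathfrak w_k$ is the sequence $(d_k^{(j)})_{0\le j\le N-1-k}$ and the eastern ray $\mathfrak e_k$ is the sequence $(d_{N-1-k-j}^{(j)})_{0\le j\le N-1-k}$, each of length $N-k$. $R_{\mathfrak w}(k)=\frac{1}{N-k}\#\{0\le j\le N-1-k: d_k^{(j)}=1\}$ and $R_{\mathfrak e}(k)=\frac{1}{N-k}\#\{0\le j\le N-1-k: d_{N-1-k-j}^{(j)}=1\}$ are the proportions of ones on $\mathfrak w_k$ and $\mathfrak e_k$.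 -}

module Defs where

open import Data.Empty using (⊥-elim)
open import Data.Fin using (Fin; toℕ; fromℕ<)
open import Data.Fin.Properties using (toℕ<n)
open import Data.Integer as ℤ using (ℤ; +_)
open import Data.Nat as ℕ using (ℕ; zero; suc; _∸_; ∣_-_∣; NonZero)
import Data.Nat.Properties as ℕ
open import Data.Product using (∃-syntax; _×_; _,_)
open import Data.Rational as ℚ using (ℚ; 0ℚ; ½; _+_; _-_; -_; _*_; _<_; _≤_; _/_)
import Data.Rational.Properties as ℚ
open import Data.Rational.Solver using (module +-*-Solver)
open import Data.Vec using (Vec; lookup; tabulate; count)
open import Relation.Binary.Definitions using (tri<; tri≈; tri>)
open import Relation.Binary.PropositionalEquality using (_≡_; refl; sym; subst)
open import Relation.Nullary using (¬_)

open +-*-Solver using (solve; _:+_; _:*_; _:-_; :-_; con; _:=_)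

------------------------------------------------------------------------
-- Real numbers as two-sided Dedekind cuts

-- `approx` is locatedness in its arithmetical form; it also makes both
-- sides of the cut inhabited.
record ℝ : Set₁ where
  field
    L U      : ℚ → Set
    L-down   : ∀ {p q} → p < q → L q → L p
    L-open   : ∀ {p} → L p → ∃[ q ] p < q × L q
    U-up     : ∀ {p q} → p < q → U p → U q
    U-open   : ∀ {q} → U q → ∃[ p ] p < q × U p
    disjoint : ∀ {q} → L q → ¬ U q
    approx   : ∀ {e} → 0ℚ < e → ∃[ l ] ∃[ u ] L l × U u × u < l + e

  L<U : ∀ {p q} → L p → U q → p < q
  L<U {p} {q} Lp Uq with ℚ.<-cmp p q
  ... | tri< p<q _ _  = p<q
  ... | tri≈ _ refl _ = ⊥-elim (disjoint Lp Uq)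
  ... | tri> _ _ q<p  = ⊥-elim (disjoint (L-down q<p Lp) Uq)

open ℝ

infix 4 _<ᴿ_ _≤ᴿ_ _∈[_,_]
infixl 6 _+ᴿ_ _-ᴿ_
infixl 7 _·_

_<ᴿ_ : ℝ → ℝ → Set
x <ᴿ y = ∃[ q ] U x q × L y q

_≤ᴿ_ : ℝ → ℝ → Set
x ≤ᴿ y = ∀ q → L x q → L y q

private
  halves : ∀ e → ½ * e + ½ * e ≡ e
  halves = solve 1 (λ e → con ½ :* e :+ con ½ :* e := e) refl

  half-pos : ∀ {e} → 0ℚ < e → 0ℚ < ½ * e
  half-pos {e} 0<e = subst (_< ½ * e) (ℚ.*-zeroʳ ½) (ℚ.*-monoʳ-<-pos ½ 0<e)

  shift : ∀ {q l e} → q - e < l → q < l + e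
  shift {q} {l} {e} lt =
    subst (_< l + e) (solve 2 (λ q e → (q :- e) :+ e := q) refl q e)
      (ℚ.+-monoˡ-< e lt)

  sub-pos : ∀ q {e} → 0ℚ < e → q - e < q
  sub-pos q {e} 0<e =
    subst (q - e <_) (ℚ.+-identityʳ q) (ℚ.+-monoʳ-< q (ℚ.neg-antimono-< 0<e))

fromℚ : ℚ → ℝ
fromℚ q = record
  { L        = _< q
  ; U        = q <_
  ; L-down   = ℚ.<-trans
  ; L-open   = λ p<q → let m , p<m , m<q = ℚ.<-dense p<q in m , p<m , m<q
  ; U-up     = λ p<r q<p → ℚ.<-trans q<p p<r
  ; U-open   = λ q<r → let m , q<m , m<r = ℚ.<-dense q<r in m , m<r , q<m
  ; disjoint = ℚ.<-asym
  ; approx   = λ 0<e →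
      let l , q-e<l , l<q = ℚ.<-dense (sub-pos q 0<e)
          u , q<u , u<l+e = ℚ.<-dense (shift q-e<l)
      in l , u , l<q , q<u , u<l+e
  }

_+ᴿ_ : ℝ → ℝ → ℝ
x +ᴿ y = record
  { L        = λ r → ∃[ s ] ∃[ t ] L x s × L y t × r ≤ s + t
  ; U        = λ r → ∃[ s ] ∃[ t ] U x s × U y t × s + t ≤ r
  ; L-down   = λ { p<q (s , t , Ls , Lt , q≤) →
                   s , t , Ls , Lt , ℚ.≤-trans (ℚ.<⇒≤ p<q) q≤ }
  ; L-open   = λ { (s , t , Ls , Lt , p≤) →
                   let s′ , s<s′ , Ls′ = L-open x Ls in
                   s′ + t , ℚ.≤-<-trans p≤ (ℚ.+-monoˡ-< t s<s′) ,
                   s′ , t , Ls′ , Lt , ℚ.≤-refl }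
  ; U-up     = λ { p<q (s , t , Us , Ut , ≤p) →
                   s , t , Us , Ut , ℚ.≤-trans ≤p (ℚ.<⇒≤ p<q) }
  ; U-open   = λ { (s , t , Us , Ut , ≤q) →
                   let s′ , s′<s , Us′ = U-open x Us in
                   s′ + t , ℚ.<-≤-trans (ℚ.+-monoˡ-< t s′<s) ≤q ,
                   s′ , t , Us′ , Ut , ℚ.≤-refl }
  ; disjoint = λ { (s , t , Ls , Lt , q≤) (s′ , t′ , Us , Ut , ≤q) →
                   ℚ.<-irrefl refl
                     (ℚ.<-≤-trans (ℚ.+-mono-< (L<U x Ls Us) (L<U y Lt Ut))
                       (ℚ.≤-trans ≤q q≤)) }
  ; approx   = λ {e} 0<e →
      let s , s′ , Ls , Us , s′< = approx x (half-pos 0<e)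
          t , t′ , Lt , Ut , t′< = approx y (half-pos 0<e)
      in s + t , s′ + t′ , (s , t , Ls , Lt , ℚ.≤-refl) ,
         (s′ , t′ , Us , Ut , ℚ.≤-refl) ,
         subst (s′ + t′ <_) (regroup s t e) (ℚ.+-mono-< s′< t′<)
  }
  where
  regroup : ∀ s t e → (s + ½ * e) + (t + ½ * e) ≡ (s + t) + e
  regroup = solve 3 (λ s t e →
    (s :+ con ½ :* e) :+ (t :+ con ½ :* e) := (s :+ t) :+ e) refl

-ᴿ_ : ℝ → ℝ
-ᴿ x = record
  { L        = λ q → U x (- q)
  ; U        = λ q → L x (- q)
  ; L-down   = λ p<q → U-up x (ℚ.neg-antimono-< p<q)
  ; L-open   = λ {p} Up → let r , r< , Ur = U-open x Up in
                 - r , subst (_< - r) (neg² p) (ℚ.neg-antimono-< r<) ,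
                 subst (U x) (sym (neg² r)) Ur
  ; U-up     = λ p<q → L-down x (ℚ.neg-antimono-< p<q)
  ; U-open   = λ {q} Lq → let r , <r , Lr = L-open x Lq in
                 - r , subst (- r <_) (neg² q) (ℚ.neg-antimono-< <r) ,
                 subst (L x) (sym (neg² r)) Lr
  ; disjoint = λ Uq Lq → disjoint x Lq Uq
  ; approx   = λ {e} 0<e → let l , u , Ll , Uu , u< = approx x 0<e in
                 - u , - l ,
                 subst (U x) (sym (neg² u)) Uu , subst (L x) (sym (neg² l)) Ll ,
                 shift (subst (_< - u) (neg-+ l e) (ℚ.neg-antimono-< u<))
  }
  where
  neg² : ∀ q → - (- q) ≡ q
  neg² = solve 1 (λ q → :- (:- q) := q) refl
  neg-+ : ∀ l e → - (l + e) ≡ - l - e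
  neg-+ = solve 2 (λ l e → :- (l :+ e) := :- l :- e) refl

_-ᴿ_ : ℝ → ℝ → ℝ
x -ᴿ y = x +ᴿ (-ᴿ y)

_·_ : ℕ → ℝ → ℝ
zero  · x = fromℚ 0ℚ
suc n · x = x +ᴿ (n · x)

fromℤ : ℤ → ℝ
fromℤ m = fromℚ (m / 1)

_∈[_,_] : ℝ → ℝ → ℝ → Set
x ∈[ a , b ] = (a ≤ᴿ x) × (x ≤ᴿ b)

-- A relation, because the floor of a real is not constructively computable.
⌊_⌋≡_ : ℝ → ℤ → Set
⌊ x ⌋≡ m = (fromℤ m ≤ᴿ x) × (x <ᴿ fromℤ (ℤ.suc m))

------------------------------------------------------------------------
-- P-G triangles

private
  up : ∀ j i {N} → suc (j ℕ.+ i) ℕ.< N → j ℕ.+ suc i ℕ.< N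
  up j i {N} = subst (ℕ._< N) (sym (ℕ.+-suc j i))

-- d u j i is d_i^{(j)}, with the row j first; the bound says that it lies
-- inside the triangle.  All values are 0 or 1.
d : ∀ {N} → Vec (Fin 2) N → (j i : ℕ) → .(j ℕ.+ i ℕ.< N) → ℕ
d u zero    i i<N = toℕ (lookup u (fromℕ< i<N))
d u (suc j) i p   = ∣ d u j (suc i) (up j i p) - d u j i (ℕ.<⇒≤ p) ∣

private
  western-bound : ∀ {N} (k : ℕ) {j} → j ℕ.< N ∸ k → j ℕ.+ k ℕ.< N
  western-bound {N} k {j} j<N∸k =
    subst (j ℕ.+ k ℕ.<_) (ℕ.m∸n+n≡m k≤N) (ℕ.+-monoˡ-< k j<N∸k)
    where
    k≤N : k ℕ.≤ N
    k≤N = ℕ.<⇒≤ (ℕ.m∸n≢0⇒n<m (ℕ.m<n⇒n≢0 j<N∸k))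

  eastern-bound : ∀ {N} (k : ℕ) {j} → j ℕ.< N ∸ k → j ℕ.+ (N ∸ 1 ∸ k ∸ j) ℕ.< N
  eastern-bound {zero}  k {j} j<N∸k with () ← subst (j ℕ.<_) (ℕ.0∸n≡0 k) j<N∸k
  eastern-bound {suc M} k {j} j<N∸k =
    subst (ℕ._< suc M) (sym (ℕ.m+[n∸m]≡n j≤M∸k)) (ℕ.s≤s (ℕ.m∸n≤m M k))
    where
    j≤M∸k : j ℕ.≤ M ∸ k
    j≤M∸k = subst (j ℕ.≤_) (ℕ.pred[m∸n]≡m∸[1+n] (suc M) k) (ℕ.<⇒≤pred j<N∸k)

western : ∀ {N} → Vec (Fin 2) N → (k : ℕ) → Vec ℕ (N ∸ k)
western {N} u k = tabulate λ j → d u (toℕ j) k (western-bound {N} k (toℕ<n j))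

eastern : ∀ {N} → Vec (Fin 2) N → (k : ℕ) → Vec ℕ (N ∸ k)
eastern {N} u k = tabulate λ j →
  d u (toℕ j) (N ∸ 1 ∸ k ∸ toℕ j) (eastern-bound {N} k (toℕ<n j))

proportionOfOnes : ∀ {n} .{{_ : NonZero n}} → Vec ℕ n → ℚ
proportionOfOnes {n} v = + count (ℕ._≟ 1) v / n

R-w R-e : ∀ {N} → Vec (Fin 2) N → (k : ℕ) → .(k ℕ.< N) → ℚ
R-w u k k<N =
  proportionOfOnes {{ℕ.>-nonZero (ℕ.m<n⇒0<n∸m k<N)}} (western u k)
R-e u k k<N =
  proportionOfOnes {{ℕ.>-nonZero (ℕ.m<n⇒0<n∸m k<N)}} (eastern u k)

{-# OPTIONS --safe #-}

-- Replace the entries d of a triangle by the signs (-1)^d, so that the sum of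
-- the signs along a ray of length n with c ones is n - 2c.  Appending a letter
-- to a word (on the right for western rays, on the left for eastern ones)
-- appends to the ray a sign that changes with that letter.  By induction, the
-- squared ray sums over all words of length N add up to n * 2^N, exactly as
-- for independent signs.  Let F u be the sum of the squared sums of both rays
-- k over all k ≤ N/D.  By Markov's inequality, P^2 * F u > N^2 for at most
-- 2^N / P words once D = 4 P^3, and for the remaining words every ray involved
-- has a proportion of ones within 1/P of 1/2, because its length is at least
-- N/2.  The theorem follows with 1/P ≤ ε and δ = 1/D.

module Submission where

open import Defs
open import Data.Fin using (Fin; zero; suc; toℕ; fromℕ<)
open import Data.Fin.Properties using (toℕ<n)
open import Data.Integer using (+_) renaming (_≤_ to _≤ᶻ_)
open import Data.Integer as ℤ using (ℤ; 0ℤ; 1ℤ; -1ℤ)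
import Data.Integer.Properties as ℤ
import Data.Integer.Tactic.RingSolver as ℤ-Solver
open import Data.List using (List; []; _∷_; _++_; [_]; length; filter; map)
open import Data.List.Membership.Propositional using (_∈_; _∉_)
open import Data.List.Membership.Propositional.Properties
  using (∈-++⁺ˡ; ∈-++⁺ʳ; ∈-map⁺; ∈-map⁻; ∈-filter⁺)
open import Data.List.Properties using (map-++; map-∘)
open import Data.List.Relation.Unary.All using ([])
open import Data.List.Relation.Unary.AllPairs using ([]; _∷_)
open import Data.List.Relation.Unary.Any using (here)
open import Data.List.Relation.Unary.Unique.Propositional using (Unique)
import Data.List.Relation.Unary.Unique.Propositional.Properties as Unique
open import Data.Nat using
  (ℕ; zero; suc; _+_; _*_; _∸_; _^_; _<_; _≤_; ∣_-_∣; z≤n; s≤s; s≤s⁻¹; s<s⁻¹; z<s;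
   NonZero; >-nonZero; _<?_; _≟_)
open import Data.Nat.DivMod using (_/_; m/n*n≤m; m*n/n≡m; /-monoˡ-≤)
open import Data.Nat.ListAction using (sum)
open import Data.Nat.ListAction.Properties using (sum-++)
open import Data.Nat.Properties
open import Data.Nat.Tactic.RingSolver using (solve-∀)
open import Data.Product using (∃-syntax; Σ-syntax; _×_; _,_)
open import Data.Rational as ℚ using (ℚ; 0ℚ; ½; mkℚ; toℚᵘ)
import Data.Rational.Properties as ℚ
open import Data.Rational.Solver using (module +-*-Solver)
open import Data.Rational.Unnormalised as ℚᵘ using (mkℚᵘ; *≤*)
import Data.Rational.Unnormalised.Properties as ℚᵘ
open import Data.Vec using (Vec; []; _∷_; _∷ʳ_; lookup; tabulate; count)
open import Data.Vec.Properties using (∷-injectiveʳ)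
open import Function using (_∘_; _∋_)
open import Relation.Binary.PropositionalEquality hiding ([_])
open import Relation.Nullary using (Dec; ¬_; yes; no; contradiction)

-- Sums over the words of a given length

words : ∀ n → List (Vec (Fin 2) n)
words zero    = [ [] ]
words (suc n) = map (zero ∷_) (words n) ++ map (suc zero ∷_) (words n)

-- Makes the length of a filtered list of words a cardinality. Words from the two halves differ in
-- their first letter.
words-unique : ∀ n → Unique (words n)
words-unique zero    = [] ∷ []
words-unique (suc n) =
  Unique.++⁺ (Unique.map⁺ ∷-injectiveʳ (words-unique n))
             (Unique.map⁺ ∷-injectiveʳ (words-unique n))
             (λ { (p , q) → disjoint (∈-map⁻ _ p) (∈-map⁻ _ q) })
  where
  disjoint : ∀ {w} → ∃[ u ] u ∈ words n × w ≡ zero ∷ u →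
             ¬ (∃[ v ] v ∈ words n × w ≡ suc zero ∷ v)
  disjoint (_ , _ , refl) (_ , _ , ())

∈-words : ∀ {n} (u : Vec (Fin 2) n) → u ∈ words n
∈-words []             = here refl
∈-words (zero ∷ u)     = ∈-++⁺ˡ (∈-map⁺ _ (∈-words u))
∈-words (suc zero ∷ u) = ∈-++⁺ʳ (map (zero ∷_) (words _)) (∈-map⁺ _ (∈-words u))

sumOver : ∀ {A : Set} → List A → (A → ℕ) → ℕ
sumOver xs f = sum (map f xs)

sumOver-cong : ∀ {A : Set} (xs : List A) {f g} → (∀ x → f x ≡ g x) → sumOver xs f ≡ sumOver xs g
sumOver-cong []       f≗g = refl
sumOver-cong (x ∷ xs) f≗g = cong₂ _+_ (f≗g x) (sumOver-cong xs f≗g)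

interchange : ∀ a b c d → (a + b) + (c + d) ≡ (a + c) + (b + d)
interchange = solve-∀

sumOver-+ : ∀ {A : Set} (xs : List A) f g → sumOver xs (λ x → f x + g x) ≡ sumOver xs f + sumOver xs g
sumOver-+ []       f g = refl
sumOver-+ (x ∷ xs) f g =
  trans (cong₂ _+_ refl (sumOver-+ xs f g)) (interchange (f x) (g x) _ _)

sumOver-const : ∀ {A : Set} (xs : List A) c → sumOver xs (λ _ → c) ≡ length xs * c
sumOver-const []       c = refl
sumOver-const (x ∷ xs) c = cong₂ _+_ refl (sumOver-const xs c)

sumOver-* : ∀ {A : Set} (xs : List A) c f → sumOver xs (λ x → c * f x) ≡ c * sumOver xs f
sumOver-* []       c f = sym (*-zeroʳ c)
sumOver-* (x ∷ xs) c f =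
  trans (cong₂ _+_ refl (sumOver-* xs c f)) (sym (*-distribˡ-+ c (f x) _))

-- Each element satisfying `P` pays for one `T` with its own term; the remaining terms are dropped.
markov : ∀ {A : Set} {P : A → Set} (P? : ∀ x → Dec (P x)) {f : A → ℕ} {T} →
         (∀ {x} → P x → T ≤ f x) → ∀ xs → length (filter P? xs) * T ≤ sumOver xs f
markov P? T≤ []       = z≤n
markov P? T≤ (x ∷ xs) with P? x
... | yes Px = +-mono-≤ (T≤ Px) (markov P? T≤ xs)
... | no  _  = ≤-trans (markov P? T≤ xs) (m≤n+m _ _)

ΣW : ∀ {n} → (Vec (Fin 2) n → ℕ) → ℕ
ΣW {n} = sumOver (words n)

Σ-∷ : ∀ {n} (f : Vec (Fin 2) (suc n) → ℕ) →
      ΣW f ≡ ΣW (λ u → f (zero ∷ u)) + ΣW (λ u → f (suc zero ∷ u))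
Σ-∷ {n} f = begin
  sum (map f (map (zero ∷_) (words n) ++ map (suc zero ∷_) (words n)))
    ≡⟨ cong sum (map-++ f (map (zero ∷_) (words n)) _) ⟩
  sum (map f (map (zero ∷_) (words n)) ++ map f (map (suc zero ∷_) (words n)))
    ≡⟨ sum-++ (map f (map (zero ∷_) (words n))) _ ⟩
  sum (map f (map (zero ∷_) (words n))) + sum (map f (map (suc zero ∷_) (words n)))
    ≡⟨ cong₂ (λ a b → sum a + sum b) (map-∘ (words n)) (map-∘ (words n)) ⟨
  ΣW (λ u → f (zero ∷ u)) + ΣW (λ u → f (suc zero ∷ u)) ∎
  where open ≡-Reasoning

-- Western rays grow with the last letter while `words` recurses on the first, so the sum is split
-- at both ends and its four parts are regrouped.
Σ-∷ʳ : ∀ {n} (f : Vec (Fin 2) (suc n) → ℕ) →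
       ΣW f ≡ ΣW (λ u → f (u ∷ʳ zero)) + ΣW (λ u → f (u ∷ʳ suc zero))
Σ-∷ʳ {zero}  f = sym (cong (_+ (f (suc zero ∷ []) + 0)) (+-identityʳ (f (zero ∷ []))))
Σ-∷ʳ {suc n} f = begin
  ΣW f
    ≡⟨ Σ-∷ f ⟩
  ΣW (λ u → f (zero ∷ u)) + ΣW (λ u → f (suc zero ∷ u))
    ≡⟨ cong₂ _+_ (Σ-∷ʳ (λ u → f (zero ∷ u))) (Σ-∷ʳ (λ u → f (suc zero ∷ u))) ⟩
  (ΣW (λ u → f (zero ∷ (u ∷ʳ zero))) + ΣW (λ u → f (zero ∷ (u ∷ʳ suc zero)))) +
  (ΣW (λ u → f (suc zero ∷ (u ∷ʳ zero))) + ΣW (λ u → f (suc zero ∷ (u ∷ʳ suc zero))))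
    ≡⟨ interchange (ΣW (λ u → f (zero ∷ (u ∷ʳ zero)))) _ _ _ ⟩
  (ΣW (λ u → f (zero ∷ (u ∷ʳ zero))) + ΣW (λ u → f (suc zero ∷ (u ∷ʳ zero)))) +
  (ΣW (λ u → f (zero ∷ (u ∷ʳ suc zero))) + ΣW (λ u → f (suc zero ∷ (u ∷ʳ suc zero))))
    ≡⟨ cong₂ _+_ (Σ-∷ (λ u → f (u ∷ʳ zero))) (Σ-∷ (λ u → f (u ∷ʳ suc zero))) ⟨
  ΣW (λ u → f (u ∷ʳ zero)) + ΣW (λ u → f (u ∷ʳ suc zero)) ∎
  where open ≡-Reasoning

length-words : ∀ n → length (words n) ≡ 2 ^ n
length-words n = begin
  length (words n)       ≡⟨ *-identityʳ _ ⟨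
  length (words n) * 1   ≡⟨ sumOver-const (words n) 1 ⟨
  ΣW {n} (λ _ → 1)       ≡⟨ Σ-one n ⟩
  2 ^ n                  ∎
  where
  open ≡-Reasoning
  Σ-one : ∀ n → ΣW {n} (λ _ → 1) ≡ 2 ^ n
  Σ-one zero    = refl
  Σ-one (suc n) = begin
    ΣW {suc n} (λ _ → 1)                    ≡⟨ Σ-∷ {n} (λ _ → 1) ⟩
    ΣW {n} (λ _ → 1) + ΣW {n} (λ _ → 1)     ≡⟨ cong₂ _+_ (Σ-one n) (Σ-one n) ⟩
    2 ^ n + 2 ^ n                           ≡⟨ cong (λ m → 2 ^ n + m) (+-identityʳ (2 ^ n)) ⟨
    2 ^ suc n                               ∎

-- Signs

-- χ x is (-1)^x for bits x, which turns absolute differences into products.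
χ : ℕ → ℤ
χ 1 = -1ℤ
χ _ = 1ℤ

χ-∣-∣ : ∀ {x y} → x ≤ 1 → y ≤ 1 → χ ∣ x - y ∣ ≡ χ x ℤ.* χ y
χ-∣-∣ z≤n       z≤n       = refl
χ-∣-∣ z≤n       (s≤s z≤n) = refl
χ-∣-∣ (s≤s z≤n) z≤n       = refl
χ-∣-∣ (s≤s z≤n) (s≤s z≤n) = refl

-- Totalised with the value 1 outside of the word.
signs : ∀ {N} → Vec (Fin 2) N → ℕ → ℤ
signs []      _       = 1ℤ
signs (b ∷ u) zero    = χ (toℕ b)
signs (b ∷ u) (suc i) = signs u i

-- The P-G rule in multiplicative form. On infinite sequences no proofs of bounds have to be carried
-- through the recursion.
entry : (ℕ → ℤ) → ℕ → ℕ → ℤ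
entry a zero    i = a i
entry a (suc j) i = entry a j (suc i) ℤ.* entry a j i

d≤1 : ∀ {N} (u : Vec (Fin 2) N) j i .(p : j + i < N) → d u j i p ≤ 1
d≤1 u zero    i p = s≤s⁻¹ (toℕ<n (lookup u (fromℕ< p)))
d≤1 u (suc j) i p = ≤-trans (∣m-n∣≤m⊔n (d u j (suc i) _) (d u j i _)) (⊔-lub (d≤1 u j (suc i) _) (d≤1 u j i _))

χ-lookup : ∀ {N} (u : Vec (Fin 2) N) i .(p : i < N) → χ (toℕ (lookup u (fromℕ< p))) ≡ signs u i
χ-lookup (b ∷ u) zero    p = refl
χ-lookup (b ∷ u) (suc i) p = χ-lookup u i (s<s⁻¹ p)

χ-d : ∀ {N} (u : Vec (Fin 2) N) j i .(p : j + i < N) → χ (d u j i p) ≡ entry (signs u) j i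
χ-d u zero    i p = χ-lookup u i p
χ-d u (suc j) i p = trans
  (χ-∣-∣ (d≤1 u j (suc i) _) (d≤1 u j i _))
  (cong₂ ℤ._*_ (χ-d u j (suc i) _) (χ-d u j i _))

entry-shift : ∀ a j i → entry a j (suc i) ≡ entry (a ∘ suc) j i
entry-shift a zero    i = refl
entry-shift a (suc j) i = cong₂ ℤ._*_ (entry-shift a j (suc i)) (entry-shift a j i)

-- Only the places from i to j + i enter the entry in row j at place i.
entry-cong : ∀ {a b} N → (∀ l → l < N → a l ≡ b l) → ∀ j i → j + i < N → entry a j i ≡ entry b j i
entry-cong N a≗b zero    i p = a≗b i p
entry-cong N a≗b (suc j) i p = cong₂ ℤ._*_
  (entry-cong N a≗b j (suc i) (subst (_< N) (sym (+-suc j i)) p)) (entry-cong N a≗b j i (<⇒≤ p))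

-- An equation instead of a case distinction: closure under products becomes a ring identity, and
-- the square is what the second moments ask for.
IsSign : ℤ → Set
IsSign x = x ℤ.* x ≡ 1ℤ

*-isSign : ∀ {x y} → IsSign x → IsSign y → IsSign (x ℤ.* y)
*-isSign {x} {y} x² y² = trans (regroup x y) (cong₂ ℤ._*_ x² y²)
  where
  regroup : ∀ x y → (x ℤ.* y) ℤ.* (x ℤ.* y) ≡ (x ℤ.* x) ℤ.* (y ℤ.* y)
  regroup = ℤ-Solver.solve-∀

signs-isSign : ∀ {N} (u : Vec (Fin 2) N) i → IsSign (signs u i)
signs-isSign []             i       = refl
signs-isSign (zero ∷ u)     zero    = refl
signs-isSign (suc zero ∷ u) zero    = refl
signs-isSign (b ∷ u)        (suc i) = signs-isSign u i

entry-isSign : ∀ {N} (u : Vec (Fin 2) N) j i → IsSign (entry (signs u) j i)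
entry-isSign u zero    i = signs-isSign u i
entry-isSign u (suc j) i = *-isSign {entry (signs u) j (suc i)} (entry-isSign u j (suc i)) (entry-isSign u j i)

-- Of the two factors of an entry at place 0, only the one at place 0 sees the first letter, so by
-- induction that letter enters with exponent 1.
flip-first : ∀ {N} (u : Vec (Fin 2) N) j →
             entry (signs (suc zero ∷ u)) j 0 ≡ ℤ.- entry (signs (zero ∷ u)) j 0
flip-first u zero    = refl
flip-first u (suc j) = begin
  entry (signs (suc zero ∷ u)) j 1 ℤ.* entry (signs (suc zero ∷ u)) j 0
    ≡⟨ cong₂ ℤ._*_ (entry-shift _ j 0) (flip-first u j) ⟩
  entry (signs u) j 0 ℤ.* ℤ.- entry (signs (zero ∷ u)) j 0
    ≡⟨ ℤ.neg-distribʳ-* (entry (signs u) j 0) _ ⟨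
  ℤ.- (entry (signs u) j 0 ℤ.* entry (signs (zero ∷ u)) j 0)
    ≡⟨ cong (λ x → ℤ.- (x ℤ.* entry (signs (zero ∷ u)) j 0)) (entry-shift (signs (zero ∷ u)) j 0) ⟨
  ℤ.- (entry (signs (zero ∷ u)) j 1 ℤ.* entry (signs (zero ∷ u)) j 0) ∎
  where open ≡-Reasoning

signs-∷ʳ : ∀ {N} (u : Vec (Fin 2) N) b l → l < N → signs (u ∷ʳ b) l ≡ signs u l
signs-∷ʳ (c ∷ u) b zero    p = refl
signs-∷ʳ (c ∷ u) b (suc l) p = signs-∷ʳ u b l (s<s⁻¹ p)

signs-∷ʳ-last : ∀ {N} (u : Vec (Fin 2) N) b → signs (u ∷ʳ b) N ≡ χ (toℕ b)
signs-∷ʳ-last []      b = refl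
signs-∷ʳ-last (c ∷ u) b = signs-∷ʳ-last u b

-- The mirror image: with j + i ≡ N the entry is the last of its row, and only its factor at place
-- suc i reaches the new letter.
flip-last : ∀ {N} (u : Vec (Fin 2) N) j i → j + i ≡ N →
            entry (signs (u ∷ʳ suc zero)) j i ≡ ℤ.- entry (signs (u ∷ʳ zero)) j i
flip-last u zero    i refl =
  trans (signs-∷ʳ-last u (suc zero)) (cong ℤ.-_ (sym (signs-∷ʳ-last u zero)))
flip-last {N} u (suc j) i eq = begin
  entry (signs (u ∷ʳ suc zero)) j (suc i) ℤ.* entry (signs (u ∷ʳ suc zero)) j i
    ≡⟨ cong₂ ℤ._*_ (flip-last u j (suc i) (trans (+-suc j i) eq)) same ⟩
  ℤ.- entry (signs (u ∷ʳ zero)) j (suc i) ℤ.* entry (signs (u ∷ʳ zero)) j i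
    ≡⟨ ℤ.neg-distribˡ-* (entry (signs (u ∷ʳ zero)) j (suc i)) _ ⟨
  ℤ.- (entry (signs (u ∷ʳ zero)) j (suc i) ℤ.* entry (signs (u ∷ʳ zero)) j i) ∎
  where
  open ≡-Reasoning
  -- The last place that enters here is j + i = N - 1, still inside `u`.
  same : entry (signs (u ∷ʳ suc zero)) j i ≡ entry (signs (u ∷ʳ zero)) j i
  same = entry-cong N (λ l l<N → trans (signs-∷ʳ u (suc zero) l l<N) (sym (signs-∷ʳ u zero l l<N)))
           j i (≤-reflexive eq)

-- Second moments

Σ< : ℕ → (ℕ → ℤ) → ℤ
Σ< zero    g = 0ℤ
Σ< (suc n) g = Σ< n g ℤ.+ g n

Σ<-cong : ∀ n {f g} → (∀ j → j < n → f j ≡ g j) → Σ< n f ≡ Σ< n g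
Σ<-cong zero    eq = refl
Σ<-cong (suc n) eq = cong₂ ℤ._+_ (Σ<-cong n (λ j j<n → eq j (m<n⇒m<1+n j<n))) (eq n ≤-refl)

-- `Σ<` peels off the last term, which suits growing rays, while `tabulate` and `count` peel off the
-- first.
Σ<-head : ∀ n g → Σ< (suc n) g ≡ g 0 ℤ.+ Σ< n (g ∘ suc)
Σ<-head zero    g = ℤ.+-comm 0ℤ (g 0)
Σ<-head (suc n) g = trans (cong (ℤ._+ g (suc n)) (Σ<-head n g)) (ℤ.+-assoc (g 0) _ _)

-- westSum covers the first n entries of the western ray k, while eastSum is
-- over the eastern ray whose whole length is n.
westSum : ∀ {N} → ℕ → ℕ → Vec (Fin 2) N → ℤ
westSum k n u = Σ< n (λ j → entry (signs u) j k)

eastSum : ∀ {N} → ℕ → Vec (Fin 2) N → ℤ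
eastSum n u = Σ< n (λ j → entry (signs u) j (n ∸ suc j))

sq : ℤ → ℕ
sq x = ℤ.∣ x ∣ * ℤ.∣ x ∣

+sq : ∀ x → + sq x ≡ x ℤ.* x
+sq (ℤ.+ n)    = ℤ.pos-* n n
+sq ℤ.-[1+ n ] = refl

-- The cross terms have opposite signs, and the square of `x` is 1.
parallelogram : ∀ s {x} → IsSign x → sq (s ℤ.+ x) + sq (s ℤ.- x) ≡ 2 * sq s + 2
parallelogram s {x} x² = ℤ.+-injective (begin
  + sq (s ℤ.+ x) ℤ.+ + sq (s ℤ.- x)
    ≡⟨ cong₂ ℤ._+_ (+sq (s ℤ.+ x)) (+sq (s ℤ.- x)) ⟩
  (s ℤ.+ x) ℤ.* (s ℤ.+ x) ℤ.+ (s ℤ.- x) ℤ.* (s ℤ.- x)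
    ≡⟨ expand s x ⟩
  + 2 ℤ.* (s ℤ.* s) ℤ.+ + 2 ℤ.* (x ℤ.* x)
    ≡⟨ cong₂ (λ a b → + 2 ℤ.* a ℤ.+ + 2 ℤ.* b) (sym (+sq s)) x² ⟩
  + 2 ℤ.* + sq s ℤ.+ + 2
    ≡⟨ cong (ℤ._+ + 2) (ℤ.pos-* 2 (sq s)) ⟨
  + (2 * sq s + 2) ∎)
  where
  open ≡-Reasoning
  expand : ∀ s x → (s ℤ.+ x) ℤ.* (s ℤ.+ x) ℤ.+ (s ℤ.- x) ℤ.* (s ℤ.- x)
                 ≡ + 2 ℤ.* (s ℤ.* s) ℤ.+ + 2 ℤ.* (x ℤ.* x)
  expand = ℤ-Solver.solve-∀

-- Each new letter appends a balanced sign to the ray, so the cross terms of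
-- the second moment cancel.
secondMoment-step : ∀ {N} {S : Vec (Fin 2) (suc N) → ℤ} {S′ : Vec (Fin 2) N → ℤ} {m}
  (extend : Fin 2 → Vec (Fin 2) N → Vec (Fin 2) (suc N)) →
  (∀ f → ΣW f ≡ ΣW (f ∘ extend zero) + ΣW (f ∘ extend (suc zero))) →
  (∀ u → ∃[ x ] IsSign x × S (extend zero u) ≡ S′ u ℤ.+ x × S (extend (suc zero) u) ≡ S′ u ℤ.- x) →
  ΣW (sq ∘ S′) ≡ m * 2 ^ N → ΣW (sq ∘ S) ≡ suc m * 2 ^ suc N
secondMoment-step {N} {S} {S′} {m} extend split balanced ih = begin
  ΣW (sq ∘ S)
    ≡⟨ split (sq ∘ S) ⟩
  ΣW (sq ∘ S ∘ extend zero) + ΣW (sq ∘ S ∘ extend (suc zero))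
    ≡⟨ sumOver-+ (words N) _ _ ⟨
  ΣW (λ u → sq (S (extend zero u)) + sq (S (extend (suc zero) u)))
    ≡⟨ sumOver-cong (words N) pointwise ⟩
  ΣW (λ u → 2 * sq (S′ u) + 2)
    ≡⟨ sumOver-+ (words N) _ _ ⟩
  ΣW (λ u → 2 * sq (S′ u)) + ΣW {N} (λ _ → 2)
    ≡⟨ cong₂ _+_ (sumOver-* (words N) 2 _) (sumOver-const (words N) 2) ⟩
  2 * ΣW (sq ∘ S′) + length (words N) * 2
    ≡⟨ cong₂ (λ a b → 2 * a + b * 2) ih (length-words N) ⟩
  2 * (m * 2 ^ N) + 2 ^ N * 2
    ≡⟨ collect m (2 ^ N) ⟩
  suc m * 2 ^ suc N ∎
  where
  open ≡-Reasoning
  collect : ∀ m p → 2 * (m * p) + p * 2 ≡ suc m * (2 * p)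
  collect = solve-∀
  pointwise : ∀ u → sq (S (extend zero u)) + sq (S (extend (suc zero) u)) ≡ 2 * sq (S′ u) + 2
  pointwise u with x , x² , eq₀ , eq₁ ← balanced u =
    trans (cong₂ (λ a b → sq a + sq b) eq₀ eq₁) (parallelogram (S′ u) x²)

ΣW-zero : ∀ N → ΣW {N} (λ _ → 0) ≡ 0
ΣW-zero N = trans (sumOver-const (words N) 0) (*-zeroʳ (length (words N)))

-- In a word of length n + k the western ray k has length n. A letter appended on the right leaves
-- its entries unchanged and adds one in row n, which that letter flips.
westSum-moment : ∀ n k → ΣW {n + k} (sq ∘ westSum k n) ≡ n * 2 ^ (n + k)
westSum-moment zero    k = ΣW-zero k
westSum-moment (suc n) k =
  secondMoment-step {S = westSum k (suc n)} {westSum k n} {n} (λ b u → u ∷ʳ b) Σ-∷ʳ balanced (westSum-moment n k)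
  where
  earlier : ∀ (u : Vec (Fin 2) (n + k)) b → westSum k n (u ∷ʳ b) ≡ westSum k n u
  earlier u b = Σ<-cong n (λ j j<n →
    entry-cong (n + k) (signs-∷ʳ u b) j k (+-monoˡ-< k j<n))
  balanced : ∀ (u : Vec (Fin 2) (n + k)) → ∃[ x ] IsSign x ×
    westSum k (suc n) (u ∷ʳ zero) ≡ westSum k n u ℤ.+ x ×
    westSum k (suc n) (u ∷ʳ suc zero) ≡ westSum k n u ℤ.- x
  balanced u = entry (signs (u ∷ʳ zero)) n k , entry-isSign (u ∷ʳ zero) n k ,
    cong₂ ℤ._+_ (earlier u zero) refl ,
    cong₂ ℤ._+_ (earlier u (suc zero)) (flip-last u n k refl)

-- Here the new letter goes in front: the old entries of the eastern ray k move one place to the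
-- right, and the ray gains the entry in row n at place 0.
eastSum-moment : ∀ n k → ΣW {n + k} (sq ∘ eastSum n) ≡ n * 2 ^ (n + k)
eastSum-moment zero    k = ΣW-zero k
eastSum-moment (suc n) k =
  secondMoment-step {S = eastSum (suc n)} {eastSum n} {n} _∷_ Σ-∷ balanced (eastSum-moment n k)
  where
  earlier : ∀ (u : Vec (Fin 2) (n + k)) b →
            Σ< n (λ j → entry (signs (b ∷ u)) j (n ∸ j)) ≡ eastSum n u
  earlier u b = Σ<-cong n (λ j j<n →
    trans (cong (entry _ j) (+-∸-assoc 1 j<n)) (entry-shift _ j (n ∸ suc j)))
  balanced : ∀ (u : Vec (Fin 2) (n + k)) → ∃[ x ] IsSign x ×
    eastSum (suc n) (zero ∷ u) ≡ eastSum n u ℤ.+ x ×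
    eastSum (suc n) (suc zero ∷ u) ≡ eastSum n u ℤ.- x
  -- The new entry lies at place suc n ∸ suc n, which reduces only to n ∸ n; it must become 0 before
  -- `flip-first` applies.
  balanced u rewrite n∸n≡0 n = entry (signs (zero ∷ u)) n 0 , entry-isSign (zero ∷ u) n 0 ,
    cong₂ ℤ._+_ (earlier u zero) refl ,
    cong₂ ℤ._+_ (earlier u (suc zero)) (flip-first u n)

-- The exceptional words

-- Encodes χ x = 1 - 2 [x = 1] with the counts on the positive side, so that no natural number is
-- subtracted.
count-∷ : ∀ x {n} (v : Vec ℕ n) → let c = count (_≟ 1) v; c′ = count (_≟ 1) (x ∷ v) in
          χ x ℤ.+ + (c′ + c′) ≡ 1ℤ ℤ.+ + (c + c)
count-∷ 0             v = refl
count-∷ 1             v = cong (λ m → -1ℤ ℤ.+ + suc m) (+-suc _ (count (_≟ 1) v))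
count-∷ (suc (suc _)) v = refl

-- The bridge from moments of signs to proportions of ones: a sign sum is n - 2c.
Σ<-count : ∀ n (f : Fin n → ℕ) {g} → (∀ j → χ (f j) ≡ g (toℕ j)) →
           let c = count (_≟ 1) (tabulate f) in Σ< n g ℤ.+ + (c + c) ≡ + n
Σ<-count zero    f     χf≗g = refl
Σ<-count (suc n) f {g} χf≗g = begin
  Σ< (suc n) g ℤ.+ + (c′ + c′)
    ≡⟨ cong (ℤ._+ + (c′ + c′)) (Σ<-head n g) ⟩
  g 0 ℤ.+ rest ℤ.+ + (c′ + c′)
    ≡⟨ cong (λ x → x ℤ.+ rest ℤ.+ + (c′ + c′)) (χf≗g zero) ⟨
  χ (f zero) ℤ.+ rest ℤ.+ + (c′ + c′)
    ≡⟨ swap (χ (f zero)) rest _ ⟩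
  χ (f zero) ℤ.+ + (c′ + c′) ℤ.+ rest
    ≡⟨ cong (ℤ._+ rest) (count-∷ (f zero) (tabulate (f ∘ suc))) ⟩
  1ℤ ℤ.+ + (c + c) ℤ.+ rest
    ≡⟨ rotate (+ (c + c)) rest ⟩
  1ℤ ℤ.+ (rest ℤ.+ + (c + c))
    ≡⟨ cong (λ x → 1ℤ ℤ.+ x) (Σ<-count n (f ∘ suc) (λ j → χf≗g (suc j))) ⟩
  + suc n ∎
  where
  open ≡-Reasoning
  c = count (_≟ 1) (tabulate (f ∘ suc))
  c′ = count (_≟ 1) (tabulate f)
  rest = Σ< n (g ∘ suc)
  swap : ∀ x y z → x ℤ.+ y ℤ.+ z ≡ x ℤ.+ z ℤ.+ y
  swap = ℤ-Solver.solve-∀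
  rotate : ∀ y z → 1ℤ ℤ.+ y ℤ.+ z ≡ 1ℤ ℤ.+ (z ℤ.+ y)
  rotate = ℤ-Solver.solve-∀

-- |ones / n - 1/2| ≤ 1/P, with denominators cleared.
record Balanced (P n ones : ℕ) : Set where
  constructor balanced
  field
    few  : P * (2 * ones) ≤ P * n + 2 * n
    many : P * n ≤ P * (2 * ones) + 2 * n

square-cancel-≤ : ∀ {m n} → m * m ≤ n * n → m ≤ n
square-cancel-≤ {m} {n} m²≤n² with n <? m
... | yes n<m = contradiction m²≤n² (<⇒≱ (*-mono-< n<m n<m))
... | no  n≮m = ≮⇒≥ n≮m

∣⊖∣≡∣-∣ : ∀ m n → ℤ.∣ m ℤ.⊖ n ∣ ≡ ∣ m - n ∣
∣⊖∣≡∣-∣ zero    zero    = refl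
∣⊖∣≡∣-∣ zero    (suc n) = refl
∣⊖∣≡∣-∣ (suc m) zero    = refl
∣⊖∣≡∣-∣ (suc m) (suc n) = trans (cong ℤ.∣_∣ (ℤ.[1+m]⊖[1+n]≡m⊖n m n)) (∣⊖∣≡∣-∣ m n)

-- The first hypothesis makes |S| the distance from 2c to n. Square roots give P |S| ≤ N ≤ 2n, and
-- division by 2nP gives |c/n - 1/2| ≤ 1/P.
balanced-by-sq : ∀ P S {n N c} → S ℤ.+ + (c + c) ≡ + n →
                 P * P * sq S ≤ N * N → N ≤ 2 * n → Balanced P n c
balanced-by-sq P S {n} {N} {c} S+2c≡n P²S²≤N² N≤2n = balanced
  (begin
    P * (2 * c)                     ≤⟨ *-monoʳ-≤ P (m≤n+∣m-n∣ (2 * c) n) ⟩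
    P * (n + ∣ 2 * c - n ∣)         ≡⟨ *-distribˡ-+ P n _ ⟩
    P * n + P * ∣ 2 * c - n ∣       ≡⟨ cong (λ z → P * n + P * z) (trans (∣-∣-comm (2 * c) n) (sym ∣S∣)) ⟩
    P * n + P * ℤ.∣ S ∣             ≤⟨ +-monoʳ-≤ (P * n) bound ⟩
    P * n + 2 * n                   ∎)
  (begin
    P * n                           ≤⟨ *-monoʳ-≤ P (m≤n+∣m-n∣ n (2 * c)) ⟩
    P * (2 * c + ∣ n - 2 * c ∣)     ≡⟨ *-distribˡ-+ P (2 * c) _ ⟩
    P * (2 * c) + P * ∣ n - 2 * c ∣ ≡⟨ cong (λ z → P * (2 * c) + P * z) ∣S∣ ⟨
    P * (2 * c) + P * ℤ.∣ S ∣       ≤⟨ +-monoʳ-≤ (P * (2 * c)) bound ⟩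
    P * (2 * c) + 2 * n             ∎)
  where
  open ≤-Reasoning
  isolate : ∀ S m → S ≡ S ℤ.+ m ℤ.- m
  isolate = ℤ-Solver.solve-∀
  ∣S∣ : ℤ.∣ S ∣ ≡ ∣ n - 2 * c ∣
  ∣S∣ = trans (cong ℤ.∣_∣ (trans (isolate S (+ (c + c)))
          (trans (cong (ℤ._- + (c + c)) S+2c≡n) (ℤ.m-n≡m⊖n n (c + c)))))
        (trans (∣⊖∣≡∣-∣ n (c + c)) (cong (λ z → ∣ n - c + z ∣) (sym (+-identityʳ c))))
  regroup : ∀ P s → P * s * (P * s) ≡ P * P * (s * s)
  regroup = solve-∀
  bound : P * ℤ.∣ S ∣ ≤ 2 * n
  bound = ≤-trans (square-cancel-≤ (≤-trans (≤-reflexive (regroup P ℤ.∣ S ∣)) P²S²≤N²)) N≤2n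

-- Markov's inequality for the energy of the long rays

Σℕ : ℕ → (ℕ → ℕ) → ℕ
Σℕ zero    f = 0
Σℕ (suc n) f = Σℕ n f + f n

term≤Σℕ : ∀ n f {k} → k < n → f k ≤ Σℕ n f
term≤Σℕ (suc n) f {k} k<1+n with k ≟ n
... | yes refl = m≤n+m (f k) _
... | no  k≢n  = ≤-trans (term≤Σℕ n f (≤∧≢⇒< (s≤s⁻¹ k<1+n) k≢n)) (m≤m+n _ (f n))

sumOver-Σℕ : ∀ {A : Set} (xs : List A) n (f : ℕ → A → ℕ) {B} →
             (∀ k → k < n → sumOver xs (f k) ≤ B) → sumOver xs (λ x → Σℕ n (λ k → f k x)) ≤ n * B
sumOver-Σℕ xs zero    f     bounds = ≤-reflexive (trans (sumOver-const xs 0) (*-zeroʳ (length xs)))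
sumOver-Σℕ xs (suc n) f {B} bounds = begin
  sumOver xs (λ x → Σℕ n (λ k → f k x) + f n x)           ≡⟨ sumOver-+ xs _ (f n) ⟩
  sumOver xs (λ x → Σℕ n (λ k → f k x)) + sumOver xs (f n)
    ≤⟨ +-mono-≤ (sumOver-Σℕ xs n f (λ k k<n → bounds k (m<n⇒m<1+n k<n))) (bounds n ≤-refl) ⟩
  n * B + B                                                ≡⟨ +-comm (n * B) B ⟩
  suc n * B                                                ∎
  where open ≤-Reasoning

-- Both rays enter one quantity, so a single exceptional set serves east and west.
energy : ∀ {N} → ℕ → Vec (Fin 2) N → ℕ
energy {N} k u = sq (westSum k (N ∸ k) u) + sq (eastSum (N ∸ k) u)

-- The exact value is 2 (N - k) 2^N; the bound forgets k so that it can be summed uniformly.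
energy-moment : ∀ {N k} → k ≤ N → ΣW {N} (energy k) ≤ N * 2 ^ N + N * 2 ^ N
energy-moment {N} {k} k≤N = begin
  ΣW {N} (energy k)
    ≡⟨ sumOver-+ (words N) _ _ ⟩
  ΣW {N} (sq ∘ westSum k (N ∸ k)) + ΣW {N} (sq ∘ eastSum (N ∸ k))
    ≡⟨ cong₂ _+_ (reindex (λ M → ΣW {M} (sq ∘ westSum k (N ∸ k)) ≡ (N ∸ k) * 2 ^ M) (westSum-moment (N ∸ k) k))
                 (reindex (λ M → ΣW {M} (sq ∘ eastSum (N ∸ k)) ≡ (N ∸ k) * 2 ^ M) (eastSum-moment (N ∸ k) k)) ⟩
  (N ∸ k) * 2 ^ N + (N ∸ k) * 2 ^ N
    ≤⟨ +-mono-≤ bound bound ⟩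
  N * 2 ^ N + N * 2 ^ N ∎
  where
  open ≤-Reasoning
  reindex : (A : ℕ → Set) → A (N ∸ k + k) → A N
  reindex A = subst A (m∸n+n≡m k≤N)
  bound : (N ∸ k) * 2 ^ N ≤ N * 2 ^ N
  bound = *-monoˡ-≤ (2 ^ N) (m∸n≤m N k)

westSum-count : ∀ {N} (u : Vec (Fin 2) N) k → let c = count (_≟ 1) (western u k) in
                westSum k (N ∸ k) u ℤ.+ + (c + c) ≡ + (N ∸ k)
westSum-count {N} u k = Σ<-count (N ∸ k) _ (λ j → χ-d u (toℕ j) k _)

eastSum-count : ∀ {N} (u : Vec (Fin 2) N) k → let c = count (_≟ 1) (eastern u k) in
                eastSum (N ∸ k) u ℤ.+ + (c + c) ≡ + (N ∸ k)
eastSum-count {N} u k = Σ<-count (N ∸ k) _ (λ j →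
  trans (χ-d u (toℕ j) (N ∸ 1 ∸ k ∸ toℕ j) _) (cong (entry (signs u) (toℕ j)) (index (toℕ j))))
  where
  -- `eastern` subtracts the 1 of N - 1 first, whereas `eastSum` has it inside suc j.
  index : ∀ j → N ∸ 1 ∸ k ∸ j ≡ N ∸ k ∸ suc j
  index j = begin
    N ∸ 1 ∸ k ∸ j     ≡⟨ cong (_∸ j) (∸-+-assoc N 1 k) ⟩
    N ∸ suc k ∸ j     ≡⟨ cong (λ m → N ∸ m ∸ j) (+-comm 1 k) ⟩
    N ∸ (k + 1) ∸ j   ≡⟨ cong (_∸ j) (∸-+-assoc N k 1) ⟨
    N ∸ k ∸ 1 ∸ j     ≡⟨ ∸-+-assoc (N ∸ k) 1 j ⟩
    N ∸ k ∸ suc j     ∎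
    where open ≡-Reasoning

module Exceptional (P D : ℕ) .{{_ : NonZero P}} .{{_ : NonZero D}} (D≡4P³ : D ≡ 4 * (P * P * P))
                   {N : ℕ} (D≤N : D ≤ N) where

  -- Counts the k with 0 ≤ k ≤ N / D, both ends included.
  K : ℕ
  K = suc (N / D)

  totalEnergy : Vec (Fin 2) N → ℕ
  totalEnergy u = Σℕ K (λ k → energy k u)

  Large? : ∀ u → Dec (N * N < P * P * totalEnergy u)
  Large? u = N * N <? P * P * totalEnergy u

  exceptional : List (Vec (Fin 2) N)
  exceptional = filter Large? (words N)

  exceptional-unique : Unique exceptional
  exceptional-unique = Unique.filter⁺ Large? (words-unique N)

  0<D : 0 < D
  0<D = subst (0 <_) (suc-pred D) z<s

  instance
    N-nonZero : NonZero N
    N-nonZero = >-nonZero (≤-trans 0<D D≤N)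

  4≤D : 4 ≤ D
  4≤D = subst (4 ≤_) (sym D≡4P³) (m≤m*n 4 (P * P * P) {{m*n≢0 (P * P) P {{m*n≢0 P P}}}})

  <K⇒≤N : ∀ k → k < K → k ≤ N
  <K⇒≤N k k<K = begin
    k         ≤⟨ s≤s⁻¹ k<K ⟩
    N / D     ≤⟨ m≤m*n (N / D) D ⟩
    N / D * D ≤⟨ m/n*n≤m N D ⟩
    N         ∎
    where open ≤-Reasoning

  -- Markov at threshold N^2 and K moments of at most 2N 2^N give `#E` N^2 ≤ 2 P^2 K N 2^N.
  -- Multiplying by D = 4 P^3 and using K D ≤ 2N leaves the factor 4 P^2 N^2 to cancel.
  exceptional-small : length exceptional * P ≤ 2 ^ N
  exceptional-small = *-cancelˡ-≤ (4 * (P * P) * (N * N)) {{nonZero}} (begin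
    4 * (P * P) * (N * N) * (#E * P)
      ≡⟨ regroup₁ P N #E ⟩
    #E * (N * N) * (4 * (P * P * P))
      ≡⟨ cong (#E * (N * N) *_) D≡4P³ ⟨
    #E * (N * N) * D
      ≤⟨ *-monoˡ-≤ D (markov Large? <⇒≤ (words N)) ⟩
    ΣW (λ u → P * P * totalEnergy u) * D
      ≡⟨ cong (_* D) (sumOver-* (words N) (P * P) totalEnergy) ⟩
    P * P * ΣW totalEnergy * D
      ≤⟨ *-monoˡ-≤ D (*-monoʳ-≤ (P * P)
           (sumOver-Σℕ (words N) K energy (λ k k<K → energy-moment (<K⇒≤N k k<K)))) ⟩
    P * P * (K * (N * 2 ^ N + N * 2 ^ N)) * D
      ≡⟨ regroup₂ P K N (2 ^ N) D ⟩
    P * P * (N * 2 ^ N + N * 2 ^ N) * (K * D)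
      -- K D is D plus (N / D) D, and each part is at most N; here the threshold D ≤ N enters.
      ≤⟨ *-monoʳ-≤ (P * P * (N * 2 ^ N + N * 2 ^ N)) (+-mono-≤ D≤N (m/n*n≤m N D)) ⟩
    P * P * (N * 2 ^ N + N * 2 ^ N) * (N + N)
      ≡⟨ regroup₃ P N (2 ^ N) ⟩
    4 * (P * P) * (N * N) * 2 ^ N ∎)
    where
    open ≤-Reasoning
    #E = length exceptional
    nonZero : NonZero (4 * (P * P) * (N * N))
    nonZero = m*n≢0 (4 * (P * P)) (N * N) {{m*n≢0 4 (P * P) {{_}} {{m*n≢0 P P}}}} {{m*n≢0 N N}}
    regroup₁ : ∀ P N E → 4 * (P * P) * (N * N) * (E * P) ≡ E * (N * N) * (4 * (P * P * P))
    regroup₁ = solve-∀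
    regroup₂ : ∀ P K N T D → P * P * (K * (N * T + N * T)) * D ≡ P * P * (N * T + N * T) * (K * D)
    regroup₂ = solve-∀
    regroup₃ : ∀ P N T → P * P * (N * T + N * T) * (N + N) ≡ 4 * (P * P) * (N * N) * T
    regroup₃ = solve-∀

  -- The integer form of k ≤ δN with δ = 1/D.
  module _ (k : ℕ) (kD≤N : k * D ≤ N) where

    2k≤N : 2 * k ≤ N
    2k≤N = begin
      2 * k ≡⟨ *-comm 2 k ⟩
      k * 2 ≤⟨ *-monoʳ-≤ k (≤-trans (s≤s (s≤s z≤n)) 4≤D) ⟩
      k * D ≤⟨ kD≤N ⟩
      N     ∎
      where open ≤-Reasoning

    k<N : k < N
    k<N with k <? N
    ... | yes k<N = k<N
    ... | no  k≮N = contradiction (≤-trans 2k≤N (≮⇒≥ k≮N)) (<⇒≱ k<2k)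
      where
      0<k : 0 < k
      0<k = ≤-trans (≤-trans 0<D D≤N) (≮⇒≥ k≮N)
      k<2k : k < 2 * k
      k<2k = subst (k <_) (cong₂ _+_ refl (sym (+-identityʳ k))) (m<m+n k 0<k)

    N≤2[N∸k] : N ≤ 2 * (N ∸ k)
    N≤2[N∸k] = begin
      N                    ≡⟨ m+n∸n≡m N N ⟨
      N + N ∸ N            ≤⟨ ∸-monoʳ-≤ (N + N) 2k≤N ⟩
      N + N ∸ 2 * k        ≡⟨ cong (λ m → N + m ∸ 2 * k) (+-identityʳ N) ⟨
      2 * N ∸ 2 * k        ≡⟨ *-distribˡ-∸ 2 N k ⟨
      2 * (N ∸ k)          ∎
      where open ≤-Reasoning

    k<K : k < K
    k<K = s≤s (subst (_≤ N / D) (m*n/n≡m k D) (/-monoˡ-≤ D kD≤N))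

    module _ {u : Vec (Fin 2) N} (u∉ : u ∉ exceptional) where

      energy-small : P * P * energy k u ≤ N * N
      energy-small = ≤-trans (*-monoʳ-≤ (P * P) (term≤Σℕ K (λ k → energy k u) k<K))
        -- Every word is listed in `words N`, so one left out by the filter cannot be large.
        (≮⇒≥ (λ large → u∉ (∈-filter⁺ Large? (∈-words u) large)))

      western-balanced : Balanced P (N ∸ k) (count (_≟ 1) (western u k))
      western-balanced = balanced-by-sq P (westSum k (N ∸ k) u) (westSum-count u k)
        (≤-trans (*-monoʳ-≤ (P * P) (m≤m+n _ _)) energy-small) N≤2[N∸k]

      eastern-balanced : Balanced P (N ∸ k) (count (_≟ 1) (eastern u k))
      eastern-balanced = balanced-by-sq P (eastSum (N ∸ k) u) (eastSum-count u k)
        (≤-trans (*-monoʳ-≤ (P * P) (m≤n+m _ _)) energy-small) N≤2[N∸k]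

-- Comparison of quotients of natural numbers

infixl 8 _÷_
_÷_ : ℕ → (n : ℕ) → .{{NonZero n}} → ℚ
m ÷ n = + m ℚ./ n

-- `ℚ` normalises fractions, while `ℚᵘ` keeps numerator and denominator as given; there order, sums
-- and products become cross multiplication.
toℚᵘ-÷ : ∀ m n → toℚᵘ (m ÷ suc n) ℚᵘ.≃ mkℚᵘ (+ m) n
toℚᵘ-÷ m n = ℚ.toℚᵘ-fromℚᵘ (mkℚᵘ (+ m) n)

÷-mono : ∀ a m b n .{{_ : NonZero m}} .{{_ : NonZero n}} → a * n ≤ b * m → a ÷ m ℚ.≤ b ÷ n
÷-mono a m@(suc m-1) b n@(suc n-1) an≤bm = ℚ.toℚᵘ-cancel-≤ (begin
  toℚᵘ (a ÷ m)     ≃⟨ toℚᵘ-÷ a m-1 ⟩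
  mkℚᵘ (+ a) m-1   ≤⟨ *≤* (subst₂ ℤ._≤_ (ℤ.pos-* a n) (ℤ.pos-* b m) (ℤ.+≤+ an≤bm)) ⟩
  mkℚᵘ (+ b) n-1   ≃⟨ toℚᵘ-÷ b n-1 ⟨
  toℚᵘ (b ÷ n)     ∎)
  where open ℚᵘ.≤-Reasoning

÷-cancel : ∀ a m b n .{{_ : NonZero m}} .{{_ : NonZero n}} → a ÷ m ℚ.≤ b ÷ n → a * n ≤ b * m
÷-cancel a m@(suc m-1) b n@(suc n-1) le
  with *≤* an≤bm ← ℚᵘ.≤-respˡ-≃ (toℚᵘ-÷ a m-1) (ℚᵘ.≤-respʳ-≃ (toℚᵘ-÷ b n-1) (ℚ.toℚᵘ-mono-≤ le))
  = ℤ.drop‿+≤+ (subst₂ ℤ._≤_ (sym (ℤ.pos-* a n)) (sym (ℤ.pos-* b m)) an≤bm)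

÷-+ : ∀ a m b n .{{_ : NonZero m}} .{{_ : NonZero n}} →
      a ÷ m ℚ.+ b ÷ n ≡ _÷_ (a * n + b * m) (m * n) {{m*n≢0 m n}}
÷-+ a m@(suc m-1) b n@(suc n-1) = ℚ.toℚᵘ-injective (begin
  toℚᵘ (a ÷ m ℚ.+ b ÷ n)            ≈⟨ ℚ.toℚᵘ-homo-+ (a ÷ m) (b ÷ n) ⟩
  toℚᵘ (a ÷ m) ℚᵘ.+ toℚᵘ (b ÷ n)    ≈⟨ ℚᵘ.+-cong (toℚᵘ-÷ a m-1) (toℚᵘ-÷ b n-1) ⟩
  mkℚᵘ (+ a) m-1 ℚᵘ.+ mkℚᵘ (+ b) n-1
    ≡⟨ cong (λ x → mkℚᵘ x (n-1 + m-1 * n)) (cong₂ ℤ._+_ (sym (ℤ.pos-* a n)) (sym (ℤ.pos-* b m))) ⟩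
  mkℚᵘ (+ (a * n + b * m)) (n-1 + m-1 * n)
    ≈⟨ toℚᵘ-÷ (a * n + b * m) (n-1 + m-1 * n) ⟨
  toℚᵘ ((a * n + b * m) ÷ (m * n)) ∎)
  where open import Relation.Binary.Reasoning.Setoid ℚᵘ.≃-setoid

÷-* : ∀ a m b n .{{_ : NonZero m}} .{{_ : NonZero n}} →
      a ÷ m ℚ.* b ÷ n ≡ _÷_ (a * b) (m * n) {{m*n≢0 m n}}
÷-* a m@(suc m-1) b n@(suc n-1) = ℚ.toℚᵘ-injective (begin
  toℚᵘ (a ÷ m ℚ.* b ÷ n)            ≈⟨ ℚ.toℚᵘ-homo-* (a ÷ m) (b ÷ n) ⟩
  toℚᵘ (a ÷ m) ℚᵘ.* toℚᵘ (b ÷ n)    ≈⟨ ℚᵘ.*-cong (toℚᵘ-÷ a m-1) (toℚᵘ-÷ b n-1) ⟩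
  mkℚᵘ (+ a) m-1 ℚᵘ.* mkℚᵘ (+ b) n-1
    ≡⟨ cong (λ x → mkℚᵘ x (n-1 + m-1 * n)) (sym (ℤ.pos-* a b)) ⟩
  mkℚᵘ (+ (a * b)) (n-1 + m-1 * n)
    ≈⟨ toℚᵘ-÷ (a * b) (n-1 + m-1 * n) ⟨
  toℚᵘ ((a * b) ÷ (m * n)) ∎)
  where open import Relation.Binary.Reasoning.Setoid ℚᵘ.≃-setoid

-- Matches one step of the repeated addition that defines `_·_`.
suc-÷1 : ∀ n q → suc n ÷ 1 ℚ.* q ≡ q ℚ.+ n ÷ 1 ℚ.* q
suc-÷1 n q = begin
  suc n ÷ 1 ℚ.* q                  ≡⟨ cong (λ m → suc m ÷ 1 ℚ.* q) (*-identityʳ n) ⟨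
  suc (n * 1) ÷ 1 ℚ.* q            ≡⟨ cong (ℚ._* q) (÷-+ 1 1 n 1) ⟨
  (1 ÷ 1 ℚ.+ n ÷ 1) ℚ.* q          ≡⟨ ℚ.*-distribʳ-+ q (1 ÷ 1) (n ÷ 1) ⟩
  1 ÷ 1 ℚ.* q ℚ.+ n ÷ 1 ℚ.* q      ≡⟨ cong (ℚ._+ n ÷ 1 ℚ.* q) (ℚ.*-identityˡ q) ⟩
  q ℚ.+ n ÷ 1 ℚ.* q                ∎
  where open ≡-Reasoning

-- A positive numerator is at least 1, so the reciprocal of the denominator of `q` will do.
unitFraction≤ : ∀ q → 0ℚ ℚ.< q → ∃[ p ] 1 ÷ suc p ℚ.≤ q
unitFraction≤ q@(mkℚ ℤ.+[1+ n ] d-1 _) 0<q = d-1 ,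
  subst (1 ÷ suc d-1 ℚ.≤_) (ℚ.↥p/↧p≡p q) (÷-mono 1 (suc d-1) (suc n) (suc d-1) (*-monoˡ-≤ (suc d-1) {1} {suc n} (s≤s z≤n)))
unitFraction≤ (mkℚ (ℤ.+ 0) _ _)     0<q with () ← ℚ.positive 0<q
unitFraction≤ (mkℚ ℤ.-[1+ _ ] _ _) 0<q with () ← ℚ.positive 0<q

-- Rational bounds for real numbers

open ℝ using (L; L-down; L-open; L<U)

cancel-neg : ∀ p q → p ℚ.- q ℚ.+ q ≡ p
cancel-neg = solve 2 (λ p q → p :- q :+ q := p) refl
  where open +-*-Solver

-- `L-down` wants a strict inequality; openness of the cut supplies the room.
L-≤ : ∀ x {p q} → p ℚ.≤ q → L x q → L x p
L-≤ x p≤q Lq with r , q<r , Lr ← L-open x Lq = L-down x (ℚ.≤-<-trans p≤q q<r) Lr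

-- Write p as q + (p - q): the first part lies below x, the second below n · x by induction.
L-· : ∀ x {q} → L x q → ∀ n {p} → p ℚ.< n ÷ 1 ℚ.* q → L (n · x) p
L-· x {q} Lq zero        p< = subst (_ ℚ.<_) (ℚ.*-zeroˡ q) p<
L-· x {q} Lq (suc n) {p} p< =
  q , p ℚ.- q , Lq , L-· x Lq n below ,
  ℚ.≤-reflexive (trans (sym (cancel-neg p q)) (ℚ.+-comm (p ℚ.- q) q))
  where
  below : p ℚ.- q ℚ.< n ÷ 1 ℚ.* q
  below = subst (p ℚ.- q ℚ.<_) (cancel q (n ÷ 1 ℚ.* q))
            (ℚ.+-monoˡ-< (ℚ.- q) (subst (p ℚ.<_) (suc-÷1 n q) p<))
    where
    open +-*-Solver
    cancel : ∀ q r → q ℚ.+ r ℚ.- q ≡ r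
    cancel = solve 2 (λ q r → q :+ r :- q := r) refl

L-·-fromℚ : ∀ q n {p} → L (n · fromℚ q) p → p ℚ.< n ÷ 1 ℚ.* q
L-·-fromℚ q zero    p<0                    = subst (_ ℚ.<_) (sym (ℚ.*-zeroˡ q)) p<0
L-·-fromℚ q (suc n) {p} (s , t , s<q , Lt , p≤) =
  subst (p ℚ.<_) (sym (suc-÷1 n q)) (ℚ.≤-<-trans p≤ (ℚ.+-mono-< s<q (L-·-fromℚ q n Lt)))

-- Were n q below p, it would lie in the lower cut of p, hence in that of n · q, hence strictly
-- below itself.
fromℚ-≤ᴿ-· : ∀ q n {p} → fromℚ p ≤ᴿ n · fromℚ q → p ℚ.≤ n ÷ 1 ℚ.* q
fromℚ-≤ᴿ-· q n p≤nq = ℚ.≮⇒≥ (λ nq<p → ℚ.<-irrefl refl (L-·-fromℚ q n (p≤nq _ nq<p)))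

-- Turns the count of exceptional words into the bound by ε: a ≤ n (1/P), and 1/P lies below x.
≤ᴿ-· : ∀ x a n P .{{_ : NonZero P}} → L x (1 ÷ P) → a * P ≤ n → fromℤ (+ a) ≤ᴿ n · x
≤ᴿ-· x a n P L1/P aP≤n p p<a = L-· x L1/P n (ℚ.<-≤-trans p<a
  (subst (a ÷ 1 ℚ.≤_) (sym (÷-* n 1 1 P))
    (÷-mono a 1 (n * 1) (1 * P) {{_}} {{m*n≢0 1 P}} (begin
      a * (1 * P) ≡⟨ cong (a *_) (*-identityˡ P) ⟩
      a * P       ≤⟨ aP≤n ⟩
      n           ≡⟨ trans (*-identityʳ (n * 1)) (*-identityʳ n) ⟨
      n * 1 * 1   ∎))))
  where open ≤-Reasoning

-- Chains k ≤ m with m ≤ N/D, the lower half of the floor relation, and clears the denominator.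
⌊⌋-bound : ∀ N D .{{_ : NonZero D}} {δ m k} → δ ≡ 1 ÷ D → ⌊ N · fromℚ δ ⌋≡ m → + k ≤ᶻ m → k * D ≤ N
⌊⌋-bound N D {δ} {k = k} δ≡1/D (m≤Nδ , _) (ℤ.+≤+ {n = m} k≤m) = begin
  k * D        ≤⟨ *-monoˡ-≤ D k≤m ⟩
  m * D        ≡⟨ cong (m *_) (*-identityˡ D) ⟨
  m * (1 * D)  ≤⟨ ÷-cancel m 1 (N * 1) (1 * D) {{_}} {{m*n≢0 1 D}} m÷1≤ ⟩
  N * 1 * 1    ≡⟨ trans (*-identityʳ (N * 1)) (*-identityʳ N) ⟩
  N            ∎
  where
  open ≤-Reasoning
  m÷1≤ : m ÷ 1 ℚ.≤ _÷_ (N * 1) (1 * D) {{m*n≢0 1 D}}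
  m÷1≤ = subst (m ÷ 1 ℚ.≤_) (trans (cong (N ÷ 1 ℚ.*_) δ≡1/D) (÷-* N 1 1 D)) (fromℚ-≤ᴿ-· δ N m≤Nδ)

-- The witness is 1 ÷ D; conversion checking becomes unusably slow when it unfolds.
abstract
  smallScale : ∀ D .{{_ : NonZero D}} → ∃[ δ ] 0ℚ ℚ.< δ ×
               (∀ N {m k} → ⌊ N · fromℚ δ ⌋≡ m → + k ≤ᶻ m → k * D ≤ N)
  smallScale D with δ , δ≡1/D ← (∃[ δ ] δ ≡ 1 ÷ D) ∋ (1 ÷ D , refl) =
    δ , subst (0ℚ ℚ.<_) (sym δ≡1/D) (ℚ.positive⁻¹ (1 ÷ D) {{ℚ.normalize-pos 1 D}}) ,
    λ N → ⌊⌋-bound N D δ≡1/D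

-- The rational η < ε stands in for ε. For the upper end, a rational p below r splits into p - η
-- below 1/2 and η below ε.
∈-interval : ∀ ε {η r} → L ε η → ½ ℚ.≤ r ℚ.+ η → r ℚ.≤ ½ ℚ.+ η →
             fromℚ r ∈[ fromℚ ½ -ᴿ ε , fromℚ ½ +ᴿ ε ]
∈-interval ε {η} {r} Lη ½≤r+η r≤½+η = lower , upper
  where
  open ℚ.≤-Reasoning
  lower : fromℚ ½ -ᴿ ε ≤ᴿ fromℚ r
  lower p (s , t , s<½ , U-t , p≤s+t) = begin-strict
    p                ≤⟨ p≤s+t ⟩
    s ℚ.+ t          <⟨ ℚ.+-monoˡ-< t s<½ ⟩
    ½ ℚ.+ t          ≤⟨ ℚ.+-monoˡ-≤ t ½≤r+η ⟩
    -- `U-t` places - t above ε, hence η < - t.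
    r ℚ.+ η ℚ.+ t    <⟨ ℚ.+-monoˡ-< t (ℚ.+-monoʳ-< r (L<U ε Lη U-t)) ⟩
    r ℚ.- t ℚ.+ t    ≡⟨ cancel-neg r t ⟩
    r                ∎
  upper : fromℚ r ≤ᴿ fromℚ ½ +ᴿ ε
  upper p p<r = p ℚ.- η , η , p-η<½ , Lη , ℚ.≤-reflexive (sym (cancel-neg p η))
    where
    p-η<½ : p ℚ.- η ℚ.< ½
    p-η<½ = begin-strict
      p ℚ.- η          <⟨ ℚ.+-monoˡ-< (ℚ.- η) p<r ⟩
      r ℚ.- η          ≤⟨ ℚ.+-monoˡ-≤ (ℚ.- η) r≤½+η ⟩
      ½ ℚ.+ η ℚ.- η    ≡⟨ ℚ.+-assoc ½ η (ℚ.- η) ⟩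
      ½ ℚ.+ (η ℚ.- η)  ≡⟨ cong (λ z → ½ ℚ.+ z) (ℚ.+-inverseʳ η) ⟩
      ½ ℚ.+ 0ℚ         ≡⟨ ℚ.+-identityʳ ½ ⟩
      ½                ∎

balanced⇒∈-interval : ∀ ε P .{{_ : NonZero P}} → L ε (1 ÷ P) → ∀ {n c} .{{_ : NonZero n}} →
                      Balanced P n c → fromℚ (c ÷ n) ∈[ fromℚ ½ -ᴿ ε , fromℚ ½ +ᴿ ε ]
balanced⇒∈-interval ε P L1/P {n} {c} {{n≢0}} (balanced few many) = ∈-interval ε L1/P
  (subst (½ ℚ.≤_) (sym (÷-+ c n 1 P))
    (÷-mono 1 2 (c * P + 1 * n) (n * P) {{_}} {{m*n≢0 n P}} (begin
      1 * (n * P)             ≡⟨ trans (*-identityˡ (n * P)) (*-comm n P) ⟩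
      P * n                   ≤⟨ many ⟩
      P * (2 * c) + 2 * n     ≡⟨ regroup₁ P c n ⟩
      (c * P + 1 * n) * 2     ∎)))
  (subst (c ÷ n ℚ.≤_) (sym (÷-+ 1 2 1 P))
    (÷-mono c n (1 * P + 1 * 2) (2 * P) {{n≢0}} {{m*n≢0 2 P}} (begin
      c * (2 * P)             ≡⟨ regroup₂ P c ⟩
      P * (2 * c)             ≤⟨ few ⟩
      P * n + 2 * n           ≡⟨ regroup₃ P n ⟩
      (1 * P + 1 * 2) * n     ∎)))
  where
  open ≤-Reasoning
  regroup₁ : ∀ P c n → P * (2 * c) + 2 * n ≡ (c * P + 1 * n) * 2
  regroup₁ = solve-∀
  regroup₂ : ∀ P c → c * (2 * P) ≡ P * (2 * c)
  regroup₂ = solve-∀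
  regroup₃ : ∀ P n → P * n + 2 * n ≡ (1 * P + 1 * 2) * n
  regroup₃ = solve-∀

-- Here `δ` is an arbitrary real, known only through what its floors imply, so the value chosen for
-- it never has to be unfolded.
equidistribution : ∀ ε P D .{{_ : NonZero P}} .{{_ : NonZero D}} → L ε (1 ÷ P) → D ≡ 4 * (P * P * P) →
  ∀ δ → (∀ N {m k} → ⌊ N · δ ⌋≡ m → + k ≤ᶻ m → k * D ≤ N) →
  ∀ N → D ≤ N → Σ[ E ∈ List (Vec (Fin 2) N) ]
    Unique E ×
    (fromℤ (+ length E) ≤ᴿ (2 ^ N) · ε) ×
    ((u : Vec (Fin 2) N) → u ∉ E →
     ∀ m → ⌊ N · δ ⌋≡ m → (k : ℕ) → + k ≤ᶻ m →
     Σ[ k<N ∈ k < N ]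
       (fromℚ (R-w u k k<N) ∈[ fromℚ ½ -ᴿ ε , fromℚ ½ +ᴿ ε ]) ×
       (fromℚ (R-e u k k<N) ∈[ fromℚ ½ -ᴿ ε , fromℚ ½ +ᴿ ε ]))
equidistribution ε P D L1/P D≡4P³ δ k*D≤ N D≤N =
  exceptional , exceptional-unique ,
  ≤ᴿ-· ε (length exceptional) (2 ^ N) P L1/P exceptional-small ,
  λ u u∉ m ⌊Nδ⌋≡m k k≤m →
    let kD≤N = k*D≤ N ⌊Nδ⌋≡m k≤m
        instance N∸k-nonZero = >-nonZero (m<n⇒0<n∸m (k<N k kD≤N))
    in k<N k kD≤N ,
       balanced⇒∈-interval ε P L1/P (western-balanced k kD≤N u∉) ,
       balanced⇒∈-interval ε P L1/P (eastern-balanced k kD≤N u∉)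
  where open Exceptional P D D≡4P³ D≤N

theorem2p5 : (ε : ℝ) → fromℚ 0ℚ <ᴿ ε → ε <ᴿ fromℚ ½ →
    Σ[ δ ∈ ℝ ] (fromℚ 0ℚ <ᴿ δ) × (Σ[ N₀ ∈ ℕ ] ((N : ℕ) → N₀ ≤ N →
    Σ[ E ∈ List (Vec (Fin 2) N) ]
    Unique E ×
    (fromℤ (+ length E) ≤ᴿ (2 ^ N) · ε) ×
    ((u : Vec (Fin 2) N) → u ∉ E →
    ∀ m → ⌊ N · δ ⌋≡ m → (k : ℕ) → + k ≤ᶻ m →
    Σ[ k<N ∈ k < N ]
    (fromℚ (R-w u k k<N) ∈[ fromℚ ½ -ᴿ ε , fromℚ ½ +ᴿ ε ]) ×
    (fromℚ (R-e u k k<N) ∈[ fromℚ ½ -ᴿ ε , fromℚ ½ +ᴿ ε ]))))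
theorem2p5 ε (q , 0<q , Lq) _ =
  -- The rational q lies strictly between 0 and ε, so P = suc p satisfies 1/P ≤ q < ε.
  let p , 1/P≤q = unitFraction≤ q 0<q
      D = 4 * (suc p * suc p * suc p)
      δ , 0<δ , k*D≤ = smallScale D
  -- D also serves as the threshold for N. Positivity of the real δ asks for a rational strictly
  -- between 0 and δ, hence density.
  in fromℚ δ , ℚ.<-dense 0<δ , D ,
     equidistribution ε (suc p) D (L-≤ ε 1/P≤q Lq) refl (fromℚ δ) k*D≤
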